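{- Let $\Gamma=\forall x\forall y:\phi(x,y)\wedge\bigwedge_{k\in[m]}\forall x\exists y:\beta_k(x,y)$ be an $\mathbf{FO}^2$ sentence in Scott normal form and $\Delta=\{e_1,\dots,e_n\}$ a finite non-empty domain. Let $i\in[n]$, let $\theta$ be a context of a call $\textsc{Stage-I}(i,\theta)$ of the Two-Stage Compilation algorithm (described in the context), and let $C$ and $C'$ be the circuits returned by $\textsc{Stage-I}(i+1,\theta\wedge\tau(e_i))$ and $\textsc{Stage-I}(i+1,\theta\wedge\tau'(e_i))$, respectively, where $\tau$ and $\tau'$ are two valid unary types for $e_i$. If - for every $k\in[m]$, $\beta_k(x,x)\in\tau$ iff $\beta_k(x,x)\in\tau'$; and - for every unary type $\tau''\in\mathcal U$, $\mathcal B(\tau,\tau'')=\mathcal B(\tau',\tau'')$, then $C$ and $C'$ are equivalent (have the same satisfying assignments).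
   Context: Logic. First-order logic is function-free, constant-free and without equality. Vocabularies are finite, with predicates of arity 1 or 2. In the Scott normal form, $\phi$ is quantifier-free with variables among $x,y$ and each $\beta_k(x,y)$ is a single binary atom. Ground atoms over $\Delta$ are the propositional variables. Circuits. An NNF circuit is a labelled DAG with internal nodes $\wedge,\vee$, leaves that are literals (or the constants $\top,\bot$), and a unique output node. Types. A unary type $\tau$ is a maximally consistent set of literals over the atoms $P(x)$ ($P$ unary in $\Gamma$) and $R(x,x)$ ($R$ binary in $\Gamma$). A binary type $\pi$ is a maximally consistent set of literals over the atoms $R(x,y),R(y,x)$ ($R$ binary in $\Gamma$). Types are identified with the conjunctions $\tau(x)$, $\pi(x,y)$ of their literals. $\tau$ is valid if $\tau(x)\models\phi(x,x)$; $\mathcal U$ is the set of valid unary types. For $\tau,\tau'\in\mathcal U$, $\mathcal B(\tau,\tau')$ is the set of binary types $\pi$ with $\tau(x)\wedge\tau'(y)\wedge\pi(x,y)\models\phi(x,y)\wedge\phi(y,x)$. Algorithm. A context $\theta$ is the conjunction of the ground type formulas chosen so far along the current recursion branch (for $\textsc{Stage-I}(i,\theta)$: one valid unary type for each of $e_1,\dots,e_{i-1}$). $\textsc{Extendable}(\theta)$ holds iff there is a model $\mathcal A$ over $\Delta$ with $\mathcal A\models\Gamma\wedge\theta$. $\textsc{Or}(S)$ and $\textsc{And}(S)$ create an $\vee$-node (resp. $\wedge$-node) with children $S$; empty $\textsc{Or}$ is $\bot$ and empty $\textsc{And}$ is $\top$. Two-Stage Compilation returns $\textsc{Stage-I}(1,\top)$,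 where: - $\textsc{Stage-I}(i,\theta)$: if $i=n+1$, return $\textsc{Stage-II}((1,2),\theta)$. Otherwise return $\textsc{Or}$ of the set of all nodes $\textsc{And}(\textsc{And}(\tau(e_i)),\textsc{Stage-I}(i+1,\theta\wedge\tau(e_i)))$, over all $\tau\in\mathcal U$ for which $\textsc{Extendable}(\theta\wedge\tau(e_i))$ holds, where $\textsc{And}(\tau(e_i))$ is the $\wedge$-node over the literals of $\tau(e_i)$. - $\textsc{Stage-II}((i,j),\theta)$: if $i=n$, return $\top$. Otherwise let $\tau_i,\tau_j$ be the unary types assigned to $e_i,e_j$ in $\theta$ and return $\textsc{Or}$ of the set of all nodes $\textsc{And}(\textsc{And}(\pi(e_i,e_j)),\textsc{Stage-II}(\mathrm{next}(i,j),\theta\wedge\pi(e_i,e_j)))$, over all $\pi\in\mathcal B(\tau_i,\tau_j)$ for which $\textsc{Extendable}(\theta\wedge\pi(e_i,e_j))$ holds. Here $\mathrm{next}(i,j)=(i,j+1)$ if $j<n$ and $(i+1,i+2)$ if $j=n$. Recursive calls are made only for contexts passing the $\textsc{Extendable}$ test. -}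

module Defs where

open import Data.Bool using (Bool; true; false)
import Data.Bool as Bool
open import Data.Empty using (⊥)
open import Data.Fin using (Fin; inject≤; fromℕ<; combine; remQuot; join; splitAt)
import Data.Fin.Properties as Fin
open import Data.Fin.Subset.Properties using (anySubset?)
open import Data.List using (List; []; _∷_; _++_; map; filter; concat; cartesianProduct; cartesianProductWith)
import Data.List as List
open import Data.List.Relation.Unary.All using (All)
import Data.List.Relation.Unary.All as All
import Data.List.Relation.Unary.All.Properties as All
open import Data.List.Relation.Unary.Any using (Any)
open import Data.Nat using (ℕ; zero; suc; _+_; _*_; _≤_; _≤‴_; _<‴_; ≤‴-step; ≤‴-reflexive; ≤‴-refl; NonZero; >-nonZero⁻¹)
import Data.Nat.Properties as ℕ
open import Data.Product using (_×_; _,_; proj₁; proj₂; ∃)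
import Data.Product as Product
open import Data.Sum using (_⊎_; inj₁; inj₂)
import Data.Sum as Sum
open import Data.Unit using (⊤; tt)
open import Data.Vec using (Vec; []; _∷_; _∷ʳ_; lookup; tabulate)
open import Data.Vec.Properties using (lookup∘tabulate)
open import Function using (_∘_; id; _⇔_)
open import Level using (0ℓ) renaming (suc to lsuc)
open import Relation.Binary.PropositionalEquality using (_≡_; refl; sym; trans; cong; cong₂)
open import Relation.Nullary using (¬_; Dec; yes; no; ¬?; _×-dec_; _⊎-dec_)
import Relation.Nullary.Decidable as Dec
open import Relation.Unary using (Pred)

data Literal (X : Set) : Set where
  pos neg : X → Literal X

literal : ∀ {X} → Bool → X → Literal X
literal true  = pos
literal false = neg

Assignment : Set → Set
Assignment X = X → Bool

_⊨ˡ_ : ∀ {X} → Assignment X → Literal X → Set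
σ ⊨ˡ pos v = σ v ≡ true
σ ⊨ˡ neg v = σ v ≡ false

-- A list of literals stands for their conjunction.
_⊨*_ : ∀ {X} → Assignment X → List (Literal X) → Set
σ ⊨* ls = All (σ ⊨ˡ_) ls

-- A circuit is given by its output node; a DAG is represented by its
-- unfolding from that node, which has the same satisfying assignments.
data Circuit (X : Set) : Set where
  lit    : Literal X → Circuit X
  top    : Circuit X
  bot    : Circuit X
  ∧-node : List (Circuit X) → Circuit X
  ∨-node : List (Circuit X) → Circuit X

And : ∀ {X} → List (Circuit X) → Circuit X
And []       = top
And (c ∷ cs) = ∧-node (c ∷ cs)

Or : ∀ {X} → List (Circuit X) → Circuit X
Or []       = bot
Or (c ∷ cs) = ∨-node (c ∷ cs)

data _⊨ᶜ_ {X : Set} (σ : Assignment X) : Circuit X → Set where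
  lit    : ∀ {l}  → σ ⊨ˡ l            → σ ⊨ᶜ lit l
  top    :                              σ ⊨ᶜ top
  ∧-node : ∀ {cs} → All (σ ⊨ᶜ_) cs    → σ ⊨ᶜ ∧-node cs
  ∨-node : ∀ {cs} → Any (σ ⊨ᶜ_) cs    → σ ⊨ᶜ ∨-node cs

_≈ᶜ_ : ∀ {X} → Circuit X → Circuit X → Set
C ≈ᶜ C′ = ∀ σ → (σ ⊨ᶜ C) ⇔ (σ ⊨ᶜ C′)

record Vocabulary : Set where
  field
    #unary  : ℕ
    #binary : ℕ

data Var : Set where
  𝑥 𝑦 : Var

module Logic (V : Vocabulary) where
  open Vocabulary V public

  data Atom (T : Set) : Set where
    pred₁ : Fin #unary  → T → Atom T
    pred₂ : Fin #binary → T → T → Atom T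

  data IsBinary {T : Set} : Atom T → Set where
    isBinary : ∀ {R s t} → IsBinary (pred₂ R s t)

  mapAtom : ∀ {S T} → (S → T) → Atom S → Atom T
  mapAtom f (pred₁ P s)   = pred₁ P (f s)
  mapAtom f (pred₂ R s t) = pred₂ R (f s) (f t)

  ⟨_,_⟩ : ∀ {T : Set} → T → T → Var → T
  ⟨ a , b ⟩ 𝑥 = a
  ⟨ a , b ⟩ 𝑦 = b

  -- A structure with domain D is an assignment to the ground atoms over D.
  Structure : Set → Set
  Structure D = Assignment (Atom D)

  data QFFormula : Set where
    atom        : Atom Var → QFFormula
    true′ false′ : QFFormula
    ¬′_         : QFFormula → QFFormula
    _∧′_ _∨′_   : QFFormula → QFFormula → QFFormula

  infix 4 _⊨_[_]
  _⊨_[_] : ∀ {D} → Structure D → QFFormula → (Var → D) → Set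
  A ⊨ atom α   [ ρ ] = A (mapAtom ρ α) ≡ true
  A ⊨ true′    [ ρ ] = ⊤
  A ⊨ false′   [ ρ ] = ⊥
  A ⊨ ¬′ φ     [ ρ ] = ¬ (A ⊨ φ [ ρ ])
  A ⊨ φ ∧′ ψ   [ ρ ] = (A ⊨ φ [ ρ ]) × (A ⊨ ψ [ ρ ])
  A ⊨ φ ∨′ ψ   [ ρ ] = (A ⊨ φ [ ρ ]) ⊎ (A ⊨ ψ [ ρ ])

  record ScottNF : Set where
    field
      φ        : QFFormula
      m        : ℕ
      β        : Fin m → Atom Var
      β-binary : ∀ k → IsBinary (β k)

  _⊨Γ_ : ∀ {D} → Structure D → ScottNF → Set
  A ⊨Γ Γ = (∀ a b → A ⊨ φ [ ⟨ a , b ⟩ ])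
         × (∀ k a → ∃ λ b → A ⊨ atom (β k) [ ⟨ a , b ⟩ ])
    where open ScottNF Γ

  -- Types: a maximally consistent set of literals over a set of atoms
  -- contains exactly one of the two literals of each atom, so it is
  -- encoded by the vector of signs of the atoms.

  -- Signs of the atoms P(x), and of the atoms R(x,x).
  UnaryType : Set
  UnaryType = Vec Bool #unary × Vec Bool #binary

  -- Signs of the atoms R(x,y), and of the atoms R(y,x).
  BinaryType : Set
  BinaryType = Vec Bool #binary × Vec Bool #binary

  _at₁_ : ∀ {T} → UnaryType → T → List (Literal (Atom T))
  (us , bs) at₁ t = List.tabulate (λ P → literal (lookup us P) (pred₁ P t))
                 ++ List.tabulate (λ R → literal (lookup bs R) (pred₂ R t t))

  _at₂_ : ∀ {T} → BinaryType → T × T → List (Literal (Atom T))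
  (fs , gs) at₂ (s , t) = List.tabulate (λ R → literal (lookup fs R) (pred₂ R s t))
                       ++ List.tabulate (λ R → literal (lookup gs R) (pred₂ R t s))

  signVectors : ∀ k → List (Vec Bool k)
  signVectors zero    = [] ∷ []
  signVectors (suc k) = cartesianProductWith _∷_ (true ∷ false ∷ []) (signVectors k)

  unaryTypes : List UnaryType
  unaryTypes = cartesianProduct (signVectors #unary) (signVectors #binary)

  binaryTypes : List BinaryType
  binaryTypes = cartesianProduct (signVectors #binary) (signVectors #binary)

  _⊨?_[_] : ∀ {D} (A : Structure D) φ (ρ : Var → D) → Dec (A ⊨ φ [ ρ ])
  A ⊨? atom α [ ρ ] = A (mapAtom ρ α) Bool.≟ true
  A ⊨? true′  [ ρ ] = yes tt
  A ⊨? false′ [ ρ ] = no λ ()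
  A ⊨? ¬′ φ   [ ρ ] = ¬? (A ⊨? φ [ ρ ])
  A ⊨? φ ∧′ ψ [ ρ ] = (A ⊨? φ [ ρ ]) ×-dec (A ⊨? ψ [ ρ ])
  A ⊨? φ ∨′ ψ [ ρ ] = (A ⊨? φ [ ρ ]) ⊎-dec (A ⊨? ψ [ ρ ])

  ⊨ˡ? : ∀ {X} (σ : Assignment X) l → Dec (σ ⊨ˡ l)
  ⊨ˡ? σ (pos v) = σ v Bool.≟ true
  ⊨ˡ? σ (neg v) = σ v Bool.≟ false

  ⊨-cong : ∀ {D E} {A : Structure D} {B : Structure E} {ρ : Var → D} {ρ′ : Var → E} →
           (∀ α → A (mapAtom ρ α) ≡ B (mapAtom ρ′ α)) →
           ∀ φ → A ⊨ φ [ ρ ] → B ⊨ φ [ ρ′ ]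
  ⊨-cong eq (atom α)  p        = trans (sym (eq α)) p
  ⊨-cong eq true′     p        = p
  ⊨-cong eq (¬′ φ)    p        = p ∘ ⊨-cong (sym ∘ eq) φ
  ⊨-cong eq (φ ∧′ ψ)  (p , q)  = ⊨-cong eq φ p , ⊨-cong eq ψ q
  ⊨-cong eq (φ ∨′ ψ)  (inj₁ p) = inj₁ (⊨-cong eq φ p)
  ⊨-cong eq (φ ∨′ ψ)  (inj₂ p) = inj₂ (⊨-cong eq ψ p)

  ⊨ˡ-cong : ∀ {X} {σ σ′ : Assignment X} → (∀ v → σ v ≡ σ′ v) → ∀ {l} → σ ⊨ˡ l → σ′ ⊨ˡ l
  ⊨ˡ-cong eq {pos v} p = trans (sym (eq v)) p
  ⊨ˡ-cong eq {neg v} p = trans (sym (eq v)) p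

  ⊨literal : ∀ {X} {σ : Assignment X} {v} s → σ v ≡ s → σ ⊨ˡ literal s v
  ⊨literal true  p = p
  ⊨literal false p = p

  literal⁻ : ∀ {X} {σ : Assignment X} {v} s → σ ⊨ˡ literal s v → σ v ≡ s
  literal⁻ true  p = p
  literal⁻ false p = p

  at₁⁺ : ∀ {D} {A : Structure D} {a} τ →
         (∀ P → A (pred₁ P a) ≡ lookup (proj₁ τ) P) →
         (∀ R → A (pred₂ R a a) ≡ lookup (proj₂ τ) R) → A ⊨* (τ at₁ a)
  at₁⁺ _ p q = All.++⁺ (All.tabulate⁺ λ P → ⊨literal _ (p P)) (All.tabulate⁺ λ R → ⊨literal _ (q R))

  at₁⁻ : ∀ {D} {A : Structure D} {a} τ → A ⊨* (τ at₁ a) →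
         (∀ P → A (pred₁ P a) ≡ lookup (proj₁ τ) P) ×
         (∀ R → A (pred₂ R a a) ≡ lookup (proj₂ τ) R)
  at₁⁻ _ h with p , q ← All.++⁻ (List.tabulate _) h =
    (λ P → literal⁻ _ (All.tabulate⁻ p P)) , (λ R → literal⁻ _ (All.tabulate⁻ q R))

  at₂⁺ : ∀ {D} {A : Structure D} {a b} π →
         (∀ R → A (pred₂ R a b) ≡ lookup (proj₁ π) R) →
         (∀ R → A (pred₂ R b a) ≡ lookup (proj₂ π) R) → A ⊨* (π at₂ (a , b))
  at₂⁺ _ p q = All.++⁺ (All.tabulate⁺ λ R → ⊨literal _ (p R)) (All.tabulate⁺ λ R → ⊨literal _ (q R))

  at₂⁻ : ∀ {D} {A : Structure D} {a b} π → A ⊨* (π at₂ (a , b)) →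
         (∀ R → A (pred₂ R a b) ≡ lookup (proj₁ π) R) ×
         (∀ R → A (pred₂ R b a) ≡ lookup (proj₂ π) R)
  at₂⁻ _ h with p , q ← All.++⁻ (List.tabulate _) h =
    (λ R → literal⁻ _ (All.tabulate⁻ p R)) , (λ R → literal⁻ _ (All.tabulate⁻ q R))

  #atoms : ℕ → ℕ
  #atoms n = #unary * n + #binary * (n * n)

  index : ∀ {n} → Atom (Fin n) → Fin (#atoms n)
  index {n} (pred₁ P e)   = join (#unary * n) _ (inj₁ (combine P e))
  index {n} (pred₂ R e f) = join (#unary * n) _ (inj₂ (combine R (combine e f)))

  unindex : ∀ {n} → Fin (#atoms n) → Atom (Fin n)
  unindex {n} = Sum.[ (λ i → let P , e = remQuot n i in pred₁ P e)
                    , (λ i → let R , j = remQuot (n * n) i ; e , f = remQuot n j in pred₂ R e f)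
                    ] ∘ splitAt (#unary * n)

  unindex-index : ∀ {n} (α : Atom (Fin n)) → unindex (index α) ≡ α
  unindex-index {n} (pred₁ P e)
    rewrite Fin.splitAt-join (#unary * n) (#binary * (n * n)) (inj₁ (combine P e)) =
    cong (λ (Q , f) → pred₁ Q f) (Fin.remQuot-combine {k = n} P e)
  unindex-index {n} (pred₂ R e f)
    rewrite Fin.splitAt-join (#unary * n) (#binary * (n * n)) (inj₂ (combine R (combine e f))) =
    trans (cong (λ (S , j) → let g , h = remQuot {n} n j in pred₂ S g h)
                (Fin.remQuot-combine {k = n * n} R (combine e f)))
          (cong (λ (g , h) → pred₂ R g h) (Fin.remQuot-combine {k = n} e f))

  anyStructure? : ∀ {n} {Q : Structure (Fin n) → Set} →
                  (∀ {A B} → (∀ α → A α ≡ B α) → Q A → Q B) →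
                  (∀ A → Dec (Q A)) → Dec (∃ Q)
  anyStructure? {n} {Q} resp Q? = Dec.map′
    (Product.map (λ v → lookup v ∘ index) id)
    (λ (A , q) → tabulate (A ∘ unindex) ,
       resp (λ α → sym (trans (lookup∘tabulate (A ∘ unindex) (index α)) (cong A (unindex-index α)))) q)
    (anySubset? λ v → Q? (lookup v ∘ index))

-- Indices start from 0: eᵢ is the element of Fin n with value i - 1.

module TwoStage {V : Vocabulary} (Γ : Logic.ScottNF V) (n : ℕ) .{{_ : NonZero n}} where
  open Logic V public
  open ScottNF Γ public

  Δ : Set
  Δ = Fin n

  element : ∀ {i} → i <‴ n → Δ
  element i<n = fromℕ< (ℕ.≤‴⇒≤ i<n)

  Valid : UnaryType → Set₁
  Valid τ = ∀ {D : Set} (A : Structure D) a → A ⊨* (τ at₁ a) → A ⊨ φ [ ⟨ a , a ⟩ ]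

  𝓑 : UnaryType → UnaryType → Pred BinaryType (lsuc 0ℓ)
  𝓑 τ τ′ π = ∀ {D : Set} (A : Structure D) a b →
    A ⊨* (τ at₁ a) → A ⊨* (τ′ at₁ b) → A ⊨* (π at₂ (a , b)) →
    (A ⊨ φ [ ⟨ a , b ⟩ ]) × (A ⊨ φ [ ⟨ b , a ⟩ ])

  -- A context: the types of the first i elements of Δ, followed (in the
  -- second stage) by the binary types chosen so far.
  Context₁ : ℕ → Set
  Context₁ i = Vec UnaryType i

  Context₂ : Set
  Context₂ = Context₁ n × List (BinaryType × Δ × Δ)

  conj₁ : ∀ {i} → i ≤ n → Context₁ i → List (Literal (Atom Δ))
  conj₁ i≤n θ = concat (List.tabulate λ j → lookup θ j at₁ inject≤ j i≤n)

  conj₂ : Context₂ → List (Literal (Atom Δ))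
  conj₂ (τs , πs) = conj₁ ℕ.≤-refl τs ++ concat (map (λ (π , e) → π at₂ e) πs)

  Extendable : List (Literal (Atom Δ)) → Set
  Extendable θ = ∃ λ (A : Structure Δ) → (A ⊨Γ Γ) × (A ⊨* θ)

  valid? : ∀ τ → Dec (Valid τ)
  valid? τ@(us , bs) = Dec.map′
    (λ p A a h → ⊨-cong (agree A a (at₁⁻ τ h)) φ p)
    (λ v → v M tt (at₁⁺ τ (λ _ → refl) (λ _ → refl)))
    (M ⊨? φ [ ⟨ tt , tt ⟩ ])
    where
    M : Structure ⊤
    M (pred₁ P _)   = lookup us P
    M (pred₂ R _ _) = lookup bs R
    const′ : ∀ {D : Set} {a : D} s → ⟨ a , a ⟩ s ≡ a
    const′ 𝑥 = refl
    const′ 𝑦 = refl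
    agree : ∀ {D} (A : Structure D) a →
            (∀ P → A (pred₁ P a) ≡ lookup us P) × (∀ R → A (pred₂ R a a) ≡ lookup bs R) →
            ∀ α → M (mapAtom ⟨ tt , tt ⟩ α) ≡ A (mapAtom ⟨ a , a ⟩ α)
    agree A a (p , q) (pred₁ P s)   = trans (sym (p P)) (cong (A ∘ pred₁ P) (sym (const′ s)))
    agree A a (p , q) (pred₂ R s t) =
      trans (sym (q R)) (cong₂ (λ c d → A (pred₂ R c d)) (sym (const′ s)) (sym (const′ t)))

  𝓑? : ∀ τ τ′ π → Dec (𝓑 τ τ′ π)
  𝓑? τ τ′ π = Dec.map′
    (λ (p , q) A a b h h′ h″ →
       let ag = agree A a b (at₁⁻ τ h) (at₁⁻ τ′ h′) (at₂⁻ π h″) in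
       ⊨-cong (λ { (pred₁ P 𝑥) → ag (pred₁ P 𝑥) ; (pred₁ P 𝑦) → ag (pred₁ P 𝑦)
                 ; (pred₂ R 𝑥 𝑥) → ag (pred₂ R 𝑥 𝑥) ; (pred₂ R 𝑥 𝑦) → ag (pred₂ R 𝑥 𝑦)
                 ; (pred₂ R 𝑦 𝑥) → ag (pred₂ R 𝑦 𝑥) ; (pred₂ R 𝑦 𝑦) → ag (pred₂ R 𝑦 𝑦) }) φ p ,
       ⊨-cong (λ { (pred₁ P 𝑥) → ag (pred₁ P 𝑦) ; (pred₁ P 𝑦) → ag (pred₁ P 𝑥)
                 ; (pred₂ R 𝑥 𝑥) → ag (pred₂ R 𝑦 𝑦) ; (pred₂ R 𝑥 𝑦) → ag (pred₂ R 𝑦 𝑥)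
                 ; (pred₂ R 𝑦 𝑥) → ag (pred₂ R 𝑥 𝑦) ; (pred₂ R 𝑦 𝑦) → ag (pred₂ R 𝑥 𝑥) }) φ q)
    (λ v → v M 𝑥 𝑦 (at₁⁺ τ (λ _ → refl) (λ _ → refl))
                   (at₁⁺ τ′ (λ _ → refl) (λ _ → refl))
                   (at₂⁺ π (λ _ → refl) (λ _ → refl)))
    ((M ⊨? φ [ ⟨ 𝑥 , 𝑦 ⟩ ]) ×-dec (M ⊨? φ [ ⟨ 𝑦 , 𝑥 ⟩ ]))
    where
    M : Structure Var
    M (pred₁ P 𝑥)   = lookup (proj₁ τ) P
    M (pred₁ P 𝑦)   = lookup (proj₁ τ′) P
    M (pred₂ R 𝑥 𝑥) = lookup (proj₂ τ) R
    M (pred₂ R 𝑦 𝑦) = lookup (proj₂ τ′) R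
    M (pred₂ R 𝑥 𝑦) = lookup (proj₁ π) R
    M (pred₂ R 𝑦 𝑥) = lookup (proj₂ π) R
    agree : ∀ {D} (A : Structure D) a b →
            (∀ P → A (pred₁ P a) ≡ lookup (proj₁ τ) P) × (∀ R → A (pred₂ R a a) ≡ lookup (proj₂ τ) R) →
            (∀ P → A (pred₁ P b) ≡ lookup (proj₁ τ′) P) × (∀ R → A (pred₂ R b b) ≡ lookup (proj₂ τ′) R) →
            (∀ R → A (pred₂ R a b) ≡ lookup (proj₁ π) R) × (∀ R → A (pred₂ R b a) ≡ lookup (proj₂ π) R) →
            ∀ α → M α ≡ A (mapAtom ⟨ a , b ⟩ α)
    agree A a b (p , q) (p′ , q′) (f , g) (pred₁ P 𝑥)   = sym (p P)
    agree A a b (p , q) (p′ , q′) (f , g) (pred₁ P 𝑦)   = sym (p′ P)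
    agree A a b (p , q) (p′ , q′) (f , g) (pred₂ R 𝑥 𝑥) = sym (q R)
    agree A a b (p , q) (p′ , q′) (f , g) (pred₂ R 𝑥 𝑦) = sym (f R)
    agree A a b (p , q) (p′ , q′) (f , g) (pred₂ R 𝑦 𝑥) = sym (g R)
    agree A a b (p , q) (p′ , q′) (f , g) (pred₂ R 𝑦 𝑦) = sym (q′ R)

  extendable? : ∀ θ → Dec (Extendable θ)
  extendable? θ = anyStructure?
    (λ eq ((u , e) , h) →
       ( (λ a b → ⊨-cong (eq ∘ mapAtom _) φ (u a b))
       , (λ k a → Product.map₂ (trans (sym (eq _))) (e k a)) )
       , All.map (⊨ˡ-cong eq) h)
    (λ A → ((Fin.all? λ a → Fin.all? λ b → A ⊨? φ [ ⟨ a , b ⟩ ])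
              ×-dec (Fin.all? λ k → Fin.all? λ a → Fin.any? λ b → A ⊨? atom (β k) [ ⟨ a , b ⟩ ]))
           ×-dec All.all? (⊨ˡ? A) θ)

  mutual
    -- Stage II at a position of the form (i , i + 1).
    stageII : ∀ {i} → i <‴ n → Context₂ → Circuit (Atom Δ)
    stageII (≤‴-reflexive _) θ = top
    stageII (≤‴-step 1+i<n)  θ = stageIIRow 1+i<n 1+i<n θ

    -- Stage II at a position (i , j) with i < j ≤ n; the first argument
    -- records that i is not the last index.
    stageIIRow : ∀ {i j} → suc i <‴ n → j <‴ n → Context₂ → Circuit (Atom Δ)
    stageIIRow 1+i<n j<n (τs , πs) =
      Or (map (λ π → And ( And (map lit (π at₂ (eᵢ , eⱼ)))
                         ∷ next 1+i<n j<n (τs , (π , eᵢ , eⱼ) ∷ πs)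
                         ∷ []))
              (filter (λ π → 𝓑? (lookup τs eᵢ) (lookup τs eⱼ) π
                       ×-dec extendable? (conj₂ (τs , (π , eᵢ , eⱼ) ∷ πs)))
                      binaryTypes))
      where
      eᵢ eⱼ : Δ
      eᵢ = element (≤‴-step 1+i<n)
      eⱼ = element j<n

    -- Stage II at the position following (i , j).
    next : ∀ {i j} → suc i <‴ n → j <‴ n → Context₂ → Circuit (Atom Δ)
    next 1+i<n (≤‴-reflexive _) θ = stageII 1+i<n θ
    next 1+i<n (≤‴-step 1+j<n)  θ = stageIIRow 1+i<n 1+j<n θ

  -- The circuit returned by Stage I when the first i elements have types θ.
  stageI : ∀ {i} → i ≤‴ n → Context₁ i → Circuit (Atom Δ)
  stageI ≤‴-refl       τs = stageII (ℕ.≤⇒≤‴ (>-nonZero⁻¹ n)) (τs , [])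
  stageI (≤‴-step i<n) θ  =
    Or (map (λ τ → And ( And (map lit (τ at₁ element i<n))
                       ∷ stageI i<n (θ ∷ʳ τ)
                       ∷ []))
            (filter (λ τ → valid? τ ×-dec extendable? (conj₁ (ℕ.≤‴⇒≤ i<n) (θ ∷ʳ τ)))
                    unaryTypes))

  compile : Circuit (Atom Δ)
  compile = stageI ℕ.0≤‴n []

  -- The contexts of the calls of Stage I made when compiling.
  data StageICall : ∀ {i} → i ≤‴ n → Context₁ i → Set₁ where
    start : StageICall ℕ.0≤‴n []
    call  : ∀ {i} {i<n : i <‴ n} {θ : Context₁ i} {τ} →
            StageICall (≤‴-step i<n) θ → Valid τ →
            Extendable (conj₁ (ℕ.≤‴⇒≤ i<n) (θ ∷ʳ τ)) →
            StageICall i<n (θ ∷ʳ τ)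

{-# OPTIONS --safe #-}
-- Call two valid types interchangeable if they agree on every βₖ(x,x) and form
-- the same valid binary types with every valid type.  Replacing the unary types
-- realized in a model of Γ by interchangeable ones, element by element, while
-- keeping the atoms over two distinct elements, yields a model again: φ depends
-- on a pair only through its types, and a witness of ∃y βₖ(a,y) stays a witness.
-- Hence contexts with pointwise interchangeable types pass the same tests in the
-- recursion, and the circuits below them agree branch by branch.
module Submission where

open import Defs
open import Data.Bool using (true)
open import Data.Fin using (Fin; toℕ; inject≤)
open import Data.Fin.Properties using (_≟_; any?; inject≤-injective; toℕ-fromℕ<)
open import Data.List using (List; []; _∷_; map; filter)
open import Data.List.Membership.Propositional using (_∈_; find; lose)
open import Data.List.Membership.Propositional.Properties
  using (∈-map⁺; ∈-map⁻; ∈-filter⁺; ∈-filter⁻; ∈-++⁺ʳ; ∈-tabulate⁺)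
open import Data.List.Relation.Unary.All using (All; []; _∷_)
import Data.List.Relation.Unary.All as All
import Data.List.Relation.Unary.All.Properties as All
open import Data.List.Relation.Unary.Any using (Any)
open import Data.Nat using (ℕ; suc; NonZero; _≤_; _<_; _≤‴_; _<‴_; ≤‴-reflexive; ≤‴-refl; ≤‴-step; >-nonZero⁻¹)
import Data.Nat.Properties as ℕ
open import Data.Product using (_×_; _,_; proj₁; proj₂; ∃; swap)
open import Data.Vec using (Vec; []; _∷_; _∷ʳ_; lookup; tabulate)
open import Data.Vec.Properties using (lookup∘tabulate; tabulate∘lookup; tabulate-cong)
open import Data.Vec.Relation.Binary.Pointwise.Inductive using (Pointwise; []; _∷_)
import Data.Vec.Relation.Binary.Pointwise.Inductive as Pointwise
open import Function using (_⇔_; mk⇔; Equivalence; _∘_)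
import Function.Properties.Equivalence as ⇔
open import Relation.Binary.PropositionalEquality using (_≡_; _≢_; refl; sym; trans; cong; cong₂; subst)
open import Relation.Nullary using (yes; no; contradiction)
open import Relation.Unary using (Pred; Decidable; _≐_; _⊆_)

-- Monotonicity of pointwise relations on vectors and of circuits.

module _ {a r} {A : Set a} {_~_ : A → A → Set r} where

  Pointwise-∷ʳ⁺ : ∀ {n} {xs ys : Vec A n} {x y} →
                  Pointwise _~_ xs ys → x ~ y → Pointwise _~_ (xs ∷ʳ x) (ys ∷ʳ y)
  Pointwise-∷ʳ⁺ []       q = q ∷ []
  Pointwise-∷ʳ⁺ (p ∷ ps) q = p ∷ Pointwise-∷ʳ⁺ ps q

module _ {X : Set} {σ : Assignment X} where

  Or⁺ : ∀ {cs} → Any (σ ⊨ᶜ_) cs → σ ⊨ᶜ Or cs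
  Or⁺ {_ ∷ _} = ∨-node

  Or⁻ : ∀ {cs} → σ ⊨ᶜ Or cs → Any (σ ⊨ᶜ_) cs
  Or⁻ {_ ∷ _} (∨-node p) = p

  -- The satisfied branch on the left is indexed by some `x` that passes `P`; the branch of the same
  -- `x` survives the filter on the right.
  Or-mono : ∀ {a p q} {A : Set a} {P : Pred A p} {Q : Pred A q} (P? : Decidable P) (Q? : Decidable Q)
            {f g : A → Circuit X} xs → P ⊆ Q → (∀ {x} → P x → σ ⊨ᶜ f x → σ ⊨ᶜ g x) →
            σ ⊨ᶜ Or (map f (filter P? xs)) → σ ⊨ᶜ Or (map g (filter Q? xs))
  Or-mono P? Q? xs P⊆Q f⇒g h
    with c , c∈ , σ⊨c ← find (Or⁻ h)
    with x , x∈ , refl ← ∈-map⁻ _ c∈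
    with x∈xs , px ← ∈-filter⁻ P? {xs = xs} x∈
    = Or⁺ (lose (∈-map⁺ _ (∈-filter⁺ Q? {xs = xs} x∈xs (P⊆Q px))) (f⇒g px σ⊨c))

  And-monoʳ : ∀ {b c d} → (σ ⊨ᶜ c → σ ⊨ᶜ d) → σ ⊨ᶜ And (b ∷ c ∷ []) → σ ⊨ᶜ And (b ∷ d ∷ [])
  And-monoʳ c⇒d (∧-node (p ∷ q ∷ [])) = ∧-node (p ∷ c⇒d q ∷ [])

-- Types realized in a structure, and retyping of a structure.

module Types (V : Vocabulary) where
  open Logic V

  typeOf : ∀ {D} → Structure D → D → UnaryType
  typeOf A a = tabulate (λ P → A (pred₁ P a)) , tabulate (λ R → A (pred₂ R a a))

  ⊨typeOf : ∀ {D} (A : Structure D) a → A ⊨* (typeOf A a at₁ a)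
  ⊨typeOf A a = at₁⁺ (typeOf A a) (λ P → sym (lookup∘tabulate _ P)) (λ R → sym (lookup∘tabulate _ R))

  typeOf-unique : ∀ {D} {A : Structure D} {a} τ → A ⊨* (τ at₁ a) → typeOf A a ≡ τ
  typeOf-unique τ h with p , q ← at₁⁻ τ h =
    cong₂ _,_ (trans (tabulate-cong p) (tabulate∘lookup _)) (trans (tabulate-cong q) (tabulate∘lookup _))

  binaryTypeOf : ∀ {D} → Structure D → D → D → BinaryType
  binaryTypeOf A a b = tabulate (λ R → A (pred₂ R a b)) , tabulate (λ R → A (pred₂ R b a))

  ⊨binaryTypeOf : ∀ {D} (A : Structure D) a b → A ⊨* (binaryTypeOf A a b at₂ (a , b))
  ⊨binaryTypeOf A a b =
    at₂⁺ (binaryTypeOf A a b) (λ R → sym (lookup∘tabulate _ R)) (λ R → sym (lookup∘tabulate _ R))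

  at₂-swap : ∀ {D} {A : Structure D} {a b} π → A ⊨* (π at₂ (a , b)) → A ⊨* (swap π at₂ (b , a))
  at₂-swap π h with f , g ← at₂⁻ π h = at₂⁺ (swap π) g f

  at₁⇒at₂ : ∀ {D} {A : Structure D} {a} τ → A ⊨* (τ at₁ a) → A ⊨* ((proj₂ τ , proj₂ τ) at₂ (a , a))
  at₁⇒at₂ τ h with _ , q ← at₁⁻ τ h = at₂⁺ (proj₂ τ , proj₂ τ) q q

  -- An atom over `𝑥`, `𝑦` has one of six shapes, and its sign is fixed by exactly one of the three
  -- types. The elements `a`, `b` may coincide, which also covers the diagonal.
  types-determine : ∀ {D E} {A : Structure D} {B : Structure E} {a b c d} τ τ′ π →
                    A ⊨* (τ at₁ a) → A ⊨* (τ′ at₁ b) → A ⊨* (π at₂ (a , b)) →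
                    B ⊨* (τ at₁ c) → B ⊨* (τ′ at₁ d) → B ⊨* (π at₂ (c , d)) →
                    ∀ φ → A ⊨ φ [ ⟨ a , b ⟩ ] → B ⊨ φ [ ⟨ c , d ⟩ ]
  types-determine {A = A} {B} {a} {b} {c} {d} τ τ′ π ha hb hab hc hd hcd = ⊨-cong agree
    where
    agree : ∀ α → A (mapAtom ⟨ a , b ⟩ α) ≡ B (mapAtom ⟨ c , d ⟩ α)
    agree (pred₁ P 𝑥)   = trans (proj₁ (at₁⁻ τ ha) P) (sym (proj₁ (at₁⁻ τ hc) P))
    agree (pred₁ P 𝑦)   = trans (proj₁ (at₁⁻ τ′ hb) P) (sym (proj₁ (at₁⁻ τ′ hd) P))
    agree (pred₂ R 𝑥 𝑥) = trans (proj₂ (at₁⁻ τ ha) R) (sym (proj₂ (at₁⁻ τ hc) R))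
    agree (pred₂ R 𝑦 𝑦) = trans (proj₂ (at₁⁻ τ′ hb) R) (sym (proj₂ (at₁⁻ τ′ hd) R))
    agree (pred₂ R 𝑥 𝑦) = trans (proj₁ (at₂⁻ π hab) R) (sym (proj₁ (at₂⁻ π hcd) R))
    agree (pred₂ R 𝑦 𝑥) = trans (proj₂ (at₂⁻ π hab) R) (sym (proj₂ (at₂⁻ π hcd) R))

  loop∈at₁ : ∀ {T : Set} {t : T} {R} τ → pos (pred₂ R t t) ∈ (τ at₁ t) ⇔ lookup (proj₂ τ) R ≡ true
  -- All literals of `τ` hold in `M`, so membership of the positive literal forces its sign to be
  -- `true`.
  loop∈at₁ {T} {t} {R} τ = mk⇔ (All.lookup (at₁⁺ {A = M} τ (λ _ → refl) (λ _ → refl))) from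
    where
    M : Structure T
    M (pred₁ P _)   = lookup (proj₁ τ) P
    M (pred₂ R _ _) = lookup (proj₂ τ) R
    from : lookup (proj₂ τ) R ≡ true → pos (pred₂ R t t) ∈ (τ at₁ t)
    from eq = subst (λ s → literal s (pred₂ R t t) ∈ (τ at₁ t)) eq (∈-++⁺ʳ _ (∈-tabulate⁺ R))

  -- Loops belong to the unary type of their element, so they come from `U`; only atoms joining
  -- distinct elements are inherited from `A`.
  retype : ∀ {n} → Structure (Fin n) → (Fin n → UnaryType) → Structure (Fin n)
  retype A U (pred₁ P a)   = lookup (proj₁ (U a)) P
  retype A U (pred₂ R a b) with a ≟ b
  ... | yes _ = lookup (proj₂ (U a)) R
  ... | no  _ = A (pred₂ R a b)

  module _ {n} (A : Structure (Fin n)) (U : Fin n → UnaryType) where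

    retype-loop : ∀ R a → retype A U (pred₂ R a a) ≡ lookup (proj₂ (U a)) R
    retype-loop R a with a ≟ a
    ... | yes _   = refl
    ... | no  a≢a = contradiction refl a≢a

    retype-≢ : ∀ R {a b} → a ≢ b → retype A U (pred₂ R a b) ≡ A (pred₂ R a b)
    retype-≢ R {a} {b} a≢b with a ≟ b
    ... | yes a≡b = contradiction a≡b a≢b
    ... | no  _   = refl

    retype-at₁ : ∀ a → retype A U ⊨* (U a at₁ a)
    retype-at₁ a = at₁⁺ (U a) (λ _ → refl) (λ R → retype-loop R a)

    retype-at₂ : ∀ {a b} π → a ≢ b → A ⊨* (π at₂ (a , b)) → retype A U ⊨* (π at₂ (a , b))
    retype-at₂ π a≢b h with f , g ← at₂⁻ π h =
      at₂⁺ π (λ R → trans (retype-≢ R a≢b) (f R)) (λ R → trans (retype-≢ R (a≢b ∘ sym)) (g R))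

-- Interchangeable types and models of the sentence.

module Interchange {V : Vocabulary} (Γ : Logic.ScottNF V) (n : ℕ) .{{_ : NonZero n}} where
  open TwoStage Γ n
  open Types V

  -- Carrying validity of both types lets either one serve as the valid `τ″` in `same-𝓑` of another
  -- pair.
  record Interchangeable (τ τ′ : UnaryType) : Set₁ where
    field
      valid  : Valid τ
      valid′ : Valid τ′
      same-β : ∀ k → pos (mapAtom ⟨ 𝑥 , 𝑥 ⟩ (β k)) ∈ (τ at₁ 𝑥) ⇔ pos (mapAtom ⟨ 𝑥 , 𝑥 ⟩ (β k)) ∈ (τ′ at₁ 𝑥)
      same-𝓑 : ∀ τ″ → Valid τ″ → 𝓑 τ τ″ ≐ 𝓑 τ′ τ″

  open Interchangeable

  reflexive : ∀ {τ} → Valid τ → Interchangeable τ τ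
  reflexive v = record
    { valid = v ; valid′ = v ; same-β = λ _ → ⇔.refl ; same-𝓑 = λ _ _ → (λ p → p) , (λ p → p) }

  symmetric : ∀ {τ τ′} → Interchangeable τ τ′ → Interchangeable τ′ τ
  symmetric e = record
    { valid  = valid′ e ; valid′ = valid e
    ; same-β = ⇔.sym ∘ same-β e ; same-𝓑 = λ τ″ v → swap (same-𝓑 e τ″ v) }

  𝓑-swap : ∀ τ τ′ π → 𝓑 τ τ′ π → 𝓑 τ′ τ (swap π)
  𝓑-swap τ τ′ π p A a b ha hb hab = swap (p A b a hb ha (at₂-swap (swap π) hab))

  -- `same-𝓑` exchanges the first argument only: exchange it, swap the two elements, exchange the
  -- other one, and swap back.
  𝓑-resp : ∀ {τ τ′ υ υ′} → Interchangeable τ τ′ → Interchangeable υ υ′ → 𝓑 τ υ ⊆ 𝓑 τ′ υ′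
  𝓑-resp {τ} {τ′} {υ} {υ′} e f {π} p =
    𝓑-swap υ′ τ′ (swap π)
      (proj₁ (same-𝓑 f τ′ (valid′ e)) {swap π}
        (𝓑-swap τ′ υ π (proj₁ (same-𝓑 e υ (valid f)) {π} p)))

  -- Whichever variables `s`, `t` occur in `β k`, setting both to `𝑥` gives the loop atom of `R`,
  -- and `same-β` speaks of this atom.
  loop-resp : ∀ {τ τ′} → Interchangeable τ τ′ → ∀ k {R s t} → β k ≡ pred₂ R s t →
              lookup (proj₂ τ) R ≡ true → lookup (proj₂ τ′) R ≡ true
  loop-resp {τ} {τ′} e k {R} {s} {t} eq p =
    Equivalence.to (loop∈at₁ τ′) (subst (_∈ (τ′ at₁ 𝑥)) β≡
      (Equivalence.to (same-β e k) (subst (_∈ (τ at₁ 𝑥)) (sym β≡) (Equivalence.from (loop∈at₁ τ) p))))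
    where
    ⟨𝑥,𝑥⟩ : ∀ s → ⟨ 𝑥 , 𝑥 ⟩ s ≡ 𝑥
    ⟨𝑥,𝑥⟩ 𝑥 = refl
    ⟨𝑥,𝑥⟩ 𝑦 = refl
    β≡ : pos (mapAtom ⟨ 𝑥 , 𝑥 ⟩ (β k)) ≡ pos (pred₂ R 𝑥 𝑥)
    β≡ = trans (cong (pos ∘ mapAtom ⟨ 𝑥 , 𝑥 ⟩) eq) (cong₂ (λ u v → pos (pred₂ R u v)) (⟨𝑥,𝑥⟩ s) (⟨𝑥,𝑥⟩ t))

  -- One realization satisfying the formula is enough, since its truth on the diagonal depends on
  -- the unary type alone.
  typeOf-valid : ∀ {D : Set} (A : Structure D) a → A ⊨ φ [ ⟨ a , a ⟩ ] → Valid (typeOf A a)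
  typeOf-valid A a p B c h =
    types-determine τ τ (proj₂ τ , proj₂ τ) (⊨typeOf A a) (⊨typeOf A a) (at₁⇒at₂ τ (⊨typeOf A a))
                    h h (at₁⇒at₂ τ h) φ p
    where τ = typeOf A a

  binaryTypeOf-𝓑 : ∀ {D : Set} (A : Structure D) a b → A ⊨ φ [ ⟨ a , b ⟩ ] → A ⊨ φ [ ⟨ b , a ⟩ ] →
                   𝓑 (typeOf A a) (typeOf A b) (binaryTypeOf A a b)
  binaryTypeOf-𝓑 A a b p q B c d hc hd hcd =
    types-determine τ τ′ π (⊨typeOf A a) (⊨typeOf A b) (⊨binaryTypeOf A a b) hc hd hcd φ p ,
    types-determine τ′ τ (swap π) (⊨typeOf A b) (⊨typeOf A a) (⊨binaryTypeOf A b a) hd hc (at₂-swap π hcd) φ q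
    where
    τ  = typeOf A a
    τ′ = typeOf A b
    π  = binaryTypeOf A a b

  retype-⊨Γ : ∀ {A : Structure Δ} {U} → (∀ a → Interchangeable (typeOf A a) (U a)) →
              A ⊨Γ Γ → retype A U ⊨Γ Γ
  retype-⊨Γ {A} {U} e (all , some) = all′ , λ k a → let b , h = some k a in b , witness k h
    where
    B = retype A U

    all′ : ∀ a b → B ⊨ φ [ ⟨ a , b ⟩ ]
    all′ a b with a ≟ b
    ... | yes refl = valid′ (e a) B a (retype-at₁ A U a)
    ... | no a≢b   = proj₁
      (𝓑-resp (e a) (e b) {π} (binaryTypeOf-𝓑 A a b (all a b) (all b a))
        B a b (retype-at₁ A U a) (retype-at₁ A U b) (retype-at₂ A U π a≢b (⊨binaryTypeOf A a b)))
      where π = binaryTypeOf A a b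

    -- The old `b` still works: the atom is either a loop at some `c`, handled by `loop-resp`, or
    -- joins distinct elements and is left as it was. The split is on the arguments of the atom, so
    -- loops arising from `s = t` and from `a = b` are treated alike.
    witness : ∀ k {a b} → A ⊨ atom (β k) [ ⟨ a , b ⟩ ] → B ⊨ atom (β k) [ ⟨ a , b ⟩ ]
    witness k h with β k in eq | β-binary k
    witness k {a} {b} h | pred₂ R s t | isBinary with ⟨ a , b ⟩ s | ⟨ a , b ⟩ t
    ... | c | d with c ≟ d
    ... | yes refl = loop-resp (e c) k eq (trans (lookup∘tabulate _ R) h)
    ... | no  _    = h

  -- Transfer of extendability between contexts.

  conj₁⁺ : ∀ {A : Structure Δ} {i} (i≤n : i ≤ n) (θ : Context₁ i) →
           (∀ j → A ⊨* (lookup θ j at₁ inject≤ j i≤n)) → A ⊨* conj₁ i≤n θ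
  conj₁⁺ i≤n θ h = All.concat⁺ (All.tabulate⁺ h)

  conj₁⁻ : ∀ {A : Structure Δ} {i} (i≤n : i ≤ n) (θ : Context₁ i) →
           A ⊨* conj₁ i≤n θ → ∀ j → A ⊨* (lookup θ j at₁ inject≤ j i≤n)
  conj₁⁻ i≤n θ h = All.tabulate⁻ (All.concat⁻ h)

  _~_ : ∀ {i} → Context₁ i → Context₁ i → Set₁
  _~_ = Pointwise Interchangeable

  retyping : ∀ {A : Structure Δ} {i} (i≤n : i ≤ n) {θ θ′ : Context₁ i} → θ ~ θ′ →
             A ⊨Γ Γ → A ⊨* conj₁ i≤n θ →
             ∃ λ U → (retype A U ⊨Γ Γ) × (retype A U ⊨* conj₁ i≤n θ′)
  retyping {A} i≤n {θ} {θ′} θ~θ′ A⊨Γ A⊨θ =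
    U , retype-⊨Γ (λ a → proj₁ (proj₂ (new a))) A⊨Γ ,
    conj₁⁺ i≤n θ′ λ j →
      subst (λ τ → retype A U ⊨* (τ at₁ inject≤ j i≤n)) (proj₂ (proj₂ (new _)) j refl) (retype-at₁ A U _)
    where
    -- The last component ranges over every position `j` mapped to `a`, so the value at
    -- `inject≤ j i≤n` is known without evaluating the search.
    new : ∀ a → ∃ λ τ → Interchangeable (typeOf A a) τ × (∀ j → inject≤ j i≤n ≡ a → τ ≡ lookup θ′ j)
    new a with any? (λ j → inject≤ j i≤n ≟ a)
    ... | yes (j , refl) = lookup θ′ j ,
          subst (λ τ → Interchangeable τ (lookup θ′ j)) (sym (typeOf-unique _ (conj₁⁻ i≤n θ A⊨θ j)))
                (Pointwise.lookup θ~θ′ j) ,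
          λ j′ eq → cong (lookup θ′) (sym (inject≤-injective _ _ j′ j eq))
    -- Elements beyond the context keep their own type, which is valid because `A` is a model.
    ... | no ∄j = typeOf A a , reflexive (typeOf-valid A a (proj₁ A⊨Γ a a)) ,
          λ j eq → contradiction (j , eq) ∄j
    U : Δ → UnaryType
    U a = proj₁ (new a)

  extendable₁-resp : ∀ {i} (i≤n : i ≤ n) {θ θ′ : Context₁ i} → θ ~ θ′ →
                     Extendable (conj₁ i≤n θ) → Extendable (conj₁ i≤n θ′)
  extendable₁-resp i≤n θ~θ′ (A , A⊨Γ , A⊨θ) = _ , proj₂ (retyping i≤n θ~θ′ A⊨Γ A⊨θ)

  -- Retyping may alter loops, so a chosen binary type is sure to survive only on a pair of distinct
  -- elements.
  OffDiagonal : List (BinaryType × Δ × Δ) → Set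
  OffDiagonal = All λ (_ , a , b) → a ≢ b

  extendable₂-resp : ∀ {τs τs′ : Context₁ n} {πs} → τs ~ τs′ → OffDiagonal πs →
                     Extendable (conj₂ (τs , πs)) → Extendable (conj₂ (τs′ , πs))
  extendable₂-resp {τs} {πs = πs} τs~τs′ off (A , A⊨Γ , h)
    with A⊨τs , A⊨πs ← All.++⁻ (conj₁ ℕ.≤-refl τs) h
    with U , B⊨Γ , B⊨τs′ ← retyping ℕ.≤-refl τs~τs′ A⊨Γ A⊨τs =
    retype A U , B⊨Γ ,
    All.++⁺ B⊨τs′ (All.concat⁺ (All.map⁺
      (All.zipWith (λ {(π , _)} (a≢b , p) → retype-at₂ A U π a≢b p)
                   (off , All.map⁻ {xs = πs} (All.concat⁻ A⊨πs)))))

  element-≢ : ∀ {i j} (i<n : i <‴ n) (j<n : j <‴ n) → i < j → element i<n ≢ element j<n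
  element-≢ i<n j<n i<j eq =
    ℕ.<⇒≢ i<j (trans (sym (toℕ-fromℕ< (ℕ.≤‴⇒≤ i<n))) (trans (cong toℕ eq) (toℕ-fromℕ< (ℕ.≤‴⇒≤ j<n))))

  -- Transfer of satisfaction through the two stages.

  module _ {σ : Assignment (Atom Δ)} where

    mutual
      stageII-resp : ∀ {i} (i<n : i <‴ n) {τs τs′ πs} → τs ~ τs′ → OffDiagonal πs →
                     σ ⊨ᶜ stageII i<n (τs , πs) → σ ⊨ᶜ stageII i<n (τs′ , πs)
      stageII-resp (≤‴-reflexive _) τs~τs′ off top = top
      stageII-resp (≤‴-step 1+i<n)  τs~τs′ off h   =
        stageIIRow-resp 1+i<n 1+i<n (ℕ.n<1+n _) τs~τs′ off h

      -- The invariant `i < j` keeps each newly typed pair off the diagonal, so every binary type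
      -- accepted under `τs` is accepted under `τs′`.
      stageIIRow-resp : ∀ {i j} (1+i<n : suc i <‴ n) (j<n : j <‴ n) → i < j →
                        ∀ {τs τs′ πs} → τs ~ τs′ → OffDiagonal πs →
                        σ ⊨ᶜ stageIIRow 1+i<n j<n (τs , πs) → σ ⊨ᶜ stageIIRow 1+i<n j<n (τs′ , πs)
      stageIIRow-resp 1+i<n j<n i<j τs~τs′ off =
        Or-mono _ _ binaryTypes
          (λ {π} (p , ext) →
             𝓑-resp (Pointwise.lookup τs~τs′ _) (Pointwise.lookup τs~τs′ _) {π} p ,
             extendable₂-resp τs~τs′ (off′ {π}) ext)
          (λ {π} _ → And-monoʳ (next-resp 1+i<n j<n i<j τs~τs′ (off′ {π})))
        where
        off′ : ∀ {π} → OffDiagonal ((π , _ , _) ∷ _)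
        off′ = element-≢ (≤‴-step 1+i<n) j<n i<j ∷ off

      next-resp : ∀ {i j} (1+i<n : suc i <‴ n) (j<n : j <‴ n) → i < j →
                  ∀ {τs τs′ πs} → τs ~ τs′ → OffDiagonal πs →
                  σ ⊨ᶜ next 1+i<n j<n (τs , πs) → σ ⊨ᶜ next 1+i<n j<n (τs′ , πs)
      next-resp 1+i<n (≤‴-reflexive _) i<j = stageII-resp 1+i<n
      next-resp 1+i<n (≤‴-step 1+j<n)  i<j = stageIIRow-resp 1+i<n 1+j<n (ℕ.m<n⇒m<1+n i<j)

    stageI-resp : ∀ {i} (i≤n : i ≤‴ n) {θ θ′ : Context₁ i} → θ ~ θ′ →
                  σ ⊨ᶜ stageI i≤n θ → σ ⊨ᶜ stageI i≤n θ′
    stageI-resp ≤‴-refl       θ~θ′ = stageII-resp (ℕ.≤⇒≤‴ (>-nonZero⁻¹ n)) θ~θ′ []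
    -- Both contexts are extended by the same type, which passed the validity test and is therefore
    -- interchangeable with itself.
    stageI-resp (≤‴-step i<n) θ~θ′ =
      Or-mono _ _ unaryTypes
        (λ (v , ext) → (λ {D} → v {D}) , extendable₁-resp (ℕ.≤‴⇒≤ i<n) (Pointwise-∷ʳ⁺ θ~θ′ (reflexive v)) ext)
        (λ (v , _) → And-monoʳ (stageI-resp i<n (Pointwise-∷ʳ⁺ θ~θ′ (reflexive v))))

  -- Validity, needed for reflexivity, holds for every type in the context since the calls made by
  -- the algorithm choose valid types only.
  call-~ : ∀ {i} {i≤n : i ≤‴ n} {θ : Context₁ i} → StageICall i≤n θ → θ ~ θ
  call-~ start        = []
  call-~ (call c v _) = Pointwise-∷ʳ⁺ (call-~ c) (reflexive v)

proposition20 : (V : Vocabulary) (Γ : Logic.ScottNF V) (n : ℕ) .{{_ : NonZero n}} →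
    let open TwoStage Γ n in
    ∀ {i} (i<n : i <‴ n) (θ : Context₁ i) → StageICall (≤‴-step i<n) θ →
    ∀ τ τ′ → Valid τ → Valid τ′ →
    (∀ k → pos (mapAtom ⟨ 𝑥 , 𝑥 ⟩ (β k)) ∈ (τ at₁ 𝑥) ⇔ pos (mapAtom ⟨ 𝑥 , 𝑥 ⟩ (β k)) ∈ (τ′ at₁ 𝑥)) →
    (∀ τ″ → Valid τ″ → 𝓑 τ τ″ ≐ 𝓑 τ′ τ″) →
    stageI i<n (θ ∷ʳ τ) ≈ᶜ stageI i<n (θ ∷ʳ τ′)
proposition20 V Γ n i<n θ c τ τ′ v v′ same-β same-𝓑 σ =
  mk⇔ (stageI-resp i<n (Pointwise-∷ʳ⁺ (call-~ c) e))
      -- The converse is the same implication with the two types exchanged.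
      (stageI-resp i<n (Pointwise-∷ʳ⁺ (call-~ c) (symmetric e)))
  where
  open Interchange Γ n
  e : Interchangeable τ τ′
  e = record { valid = v ; valid′ = v′ ; same-β = same-β ; same-𝓑 = same-𝓑 }
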